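{- Let $r \ge 2$ and $s \ge 3$ be integers, let $b_i = i(s-1)+1$ for $i \in \{1,\dots,r-1\}$, and let $B=\prod_{i=1}^{r-1} b_i$. Then $F^{\chi}(r, s, s+1)$ exists and $$F^{\chi}(r, s, s+1) \leq 1+s+ \sum_{i=2}^{r-1} F^{\chi}(i,s,s+1) + B \cdot F^{\chi}(r,s-1,s).$$ In particular, for all $s \geq 3$, the number $F^{\chi}(2, s, s+1)$ exists and $F^{\chi}(2, s, s+1) \leq 1 + s + s\,F^{\chi}(2, s-1 , s)$.
   Context: All graphs are finite, undirected, loopless and simple. $cl(G)$ is the clique number of $G$ and $\chi(G)$ its chromatic number. For integers $r\ge 2$ and $a_1,\dots,a_r\ge 2$, write $G \rightarrow (a_1,\dots,a_r)^v$ if for every coloring of the vertex set $V(G)$ with $r$ colors $1,\dots,r$ there is some color $i\in\{1,\dots,r\}$ such that $G$ contains a clique $K_{a_i}$ all of whose vertices have color $i$. For integers $r\ge2$, $a\ge 2$ and $t>a$, let $\mathcal{F}^{\chi}(r,a,t)$ be the set of graphs $G$ such that $G\rightarrow (a,\dots,a)^v$ (with $a$ repeated $r$ times), $cl(G)<t$ (i.e. $G$ is $K_t$-free), and $\chi(G)=r(a-1)+1$. The diagonal chromatic vertex Folkman number is $F^{\chi}(r,a,t)=\min\{|V(G)| : G\in\mathcal{F}^{\chi}(r,a,t)\}$; it is said to exist if $\mathcal{F}^{\chi}(r,a,t)$ is nonempty. An empty sum equals $0$. -}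

module Defs where

open import Level using (Level; suc; 0ℓ)
open import Data.Nat using (ℕ; _+_; _*_; _∸_; _≤_; _<_)
import Data.Nat as ℕ
open import Data.Fin using (Fin)
open import Data.List using (List; applyUpTo)
open import Data.Product using (∃; ∃-syntax; _×_)
open import Relation.Binary using (Rel; Decidable; Symmetric; Irreflexive)
open import Relation.Binary.PropositionalEquality using (_≡_; _≢_)

private
  variable
    ℓ : Level
    n : ℕ

IsMinimum : (ℕ → Set ℓ) → ℕ → Set ℓ
IsMinimum P m = P m × (∀ k → P k → m ≤ k)

IsMaximum : (ℕ → Set ℓ) → ℕ → Set ℓ
IsMaximum P m = P m × (∀ k → P k → k ≤ m)

-- The list m, m + 1, …, k, which is empty when k < m.
interval : ℕ → ℕ → List ℕ
interval m k = applyUpTo (m +_) (ℕ.suc k ∸ m)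

record Graph (n : ℕ) : Set (suc 0ℓ) where
  field
    _~_      : Rel (Fin n) 0ℓ
    ~-dec    : Decidable _~_
    ~-sym    : Symmetric _~_
    ~-irrefl : Irreflexive _≡_ _~_

-- A copy of the complete graph on a vertices; since adjacency is
-- irreflexive, the map q is automatically injective.
IsClique : Graph n → {a : ℕ} → (Fin a → Fin n) → Set
IsClique G q = ∀ i j → i ≢ j → q i ~ q j
  where open Graph G

IsProperColouring : Graph n → {k : ℕ} → (Fin n → Fin k) → Set
IsProperColouring G c = ∀ u v → u ~ v → c u ≢ c v
  where open Graph G

IsCliqueNumber : Graph n → ℕ → Set
IsCliqueNumber {n} G =
  IsMaximum (λ a → ∃ λ (q : Fin a → Fin n) → IsClique G q)

IsChromaticNumber : Graph n → ℕ → Set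
IsChromaticNumber {n} G =
  IsMinimum (λ k → ∃ λ (c : Fin n → Fin k) → IsProperColouring G c)

-- G → (a₁, …, a_r)ᵛ
Arrows : Graph n → {r : ℕ} → (Fin r → ℕ) → Set
Arrows {n} G {r} a =
  (c : Fin n → Fin r) →
  ∃ λ (i : Fin r) → ∃ λ (q : Fin (a i) → Fin n) →
    IsClique G q × (∀ j → c (q j) ≡ i)

-- Membership in 𝓕^χ(r, a, t); only meaningful for r ≥ 2, a ≥ 2 and t > a.
record InFχ (r a t : ℕ) (G : Graph n) : Set where
  field
    arrows    : Arrows G {r} (λ _ → a)
    clique    : ∃[ k ] IsCliqueNumber G k × k < t
    chromatic : IsChromaticNumber G (r * (a ∸ 1) + 1)

HasFχGraph : (r a t n : ℕ) → Set (suc 0ℓ)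
HasFχGraph r a t n = ∃ λ (G : Graph n) → InFχ r a t G

FχExists : (r a t : ℕ) → Set (suc 0ℓ)
FχExists r a t = ∃[ n ] HasFχGraph r a t n

-- IsFχ r a t m says that F^χ(r, a, t) exists and equals m.
IsFχ : (r a t m : ℕ) → Set (suc 0ℓ)
IsFχ r a t = IsMinimum (HasFχGraph r a t)

{-# OPTIONS --safe #-}
module Submission where

-- The chromatic lower bound comes for free: if G → (s, …, s)ᵛ with r colours, a colouring with r (s − 1)
-- colours could be merged into r groups of s − 1 colours, none of which contains a K_s.
--
-- A graph in 𝓕^χ(r, s, s + 1) is assembled from a vertex u, graphs G_i in 𝓕^χ(i, s, s + 1) for 1 ≤ i < r
-- (with G₁ = K_s), each with a fixed proper b_i-colouring φ_i, and one copy H_t of a graph in 𝓕^χ(r, s − 1, s)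
-- for every tuple t of colours t_i of the φ_i. The copy H_t is joined to u and to the independent sets φ_i⁻¹(t_i).
-- An r-colouring without monochromatic K_s in any G_i shows, besides the colour of u, a new colour in
-- each successive G_i; so some tuple t sees all r colours on the neighbours of H_t, and a monochromatic
-- K_{s − 1} of H_t extends to a K_s. Those neighbours receive at most r colours in a proper colouring by
-- r (s − 1) + 1 colours, which leaves r (s − 2) + 1 for H_t.
--
-- Starting from a single vertex at s = 1, the same construction gives existence by induction on s.
-- Minima exist constructively because graphs on Fin n are coded, up to logical equivalence
-- of their adjacency relations, by the elements of a finite type.

open import Data.Fin using (Fin; zero; suc; inject≤; combine; quotient; remainder; finToFun; funToFin; punchIn)
open import Data.Fin.Properties
  using (_≟_; any?; all?; pigeonhole; injective⇒≤; inject≤-injective; punchIn-injective; punchInᵢ≢i;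
         suc-injective; remQuot-combine; combine-remQuot; finToFun-funToFin; +↔⊎; *↔×; <⇒≢)
open import Data.List using (map; sum; product; _∷ʳ_)
open import Data.List.Properties using (applyUpTo-∷ʳ; map-++)
open import Data.Nat using (ℕ; zero; suc; _+_; _*_; _∸_; _^_; _≤_; _<_; z≤n; s≤s; s≤s⁻¹)
open import Data.Nat.Induction using (<-rec)
open import Data.Nat.ListAction.Properties using (sum-++; product-++)
open import Data.Nat.Properties
  using (≤-refl; ≤-reflexive; ≤-trans; n≤1+n; n<1+n; <⇒≱; ≮⇒≥; m≤n+m; m≤n⇒m≤1+n;
         +-comm; +-assoc; +-suc; +-identityʳ; *-identityʳ; *-identityˡ; *-suc; +-monoˡ-≤; +-monoʳ-≤;
         anyUpTo?)
open import Data.Product using (∃; ∃-syntax; Σ-syntax; _×_; _,_; proj₁; proj₂)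
open import Data.Sum using (_⊎_; inj₁; inj₂; [_,_]; swap)
open import Data.Sum.Function.Propositional using (_⊎-↔_)
open import Data.Sum.Relation.Binary.Pointwise using (Pointwise; inj₁; inj₂; ⊎-decidable; ⊎-symmetric; drop-inj₁; drop-inj₂)
open import Data.Unit using (⊤; tt)
open import Data.Empty using (⊥)
open import Data.Vec.Functional using (_∷_)
open import Function using (_∘_; id; _↔_; Inverse; Injective; mk↔ₛ′)
open import Function.Construct.Composition using (_↔-∘_)
open import Function.Construct.Identity using (↔-id)
open import Level using (0ℓ)
open import Relation.Binary using (Rel; REL; Decidable; Symmetric)
open import Relation.Binary.PropositionalEquality
  using (_≡_; _≢_; refl; sym; trans; cong; cong₂; subst; subst₂; ≢-sym; _≗_)
open import Relation.Nullary using (¬_; Dec; yes; no; ¬?; map′; contradiction; _×-dec_; _⊎-dec_; _→-dec_)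
open import Relation.Unary using (Pred)
open import Defs

private
  variable
    a d k l m n r : ℕ
    V W : Set

-- Injections and missed points of maps between finite sets.

some-or-all : {P Q : Fin n → Set} → (∀ j → P j ⊎ Q j) → ∃ P ⊎ (∀ j → Q j)
some-or-all {zero}  h = inj₂ λ ()
some-or-all {suc n} h with h zero | some-or-all (h ∘ suc)
... | inj₁ p | _            = inj₁ (zero , p)
... | inj₂ _ | inj₁ (j , p) = inj₁ (suc j , p)
... | inj₂ p | inj₂ ps      = inj₂ λ { zero → p ; (suc j) → ps j }

∷-injective : {g : Fin k → Fin r} {x : Fin r} →
              Injective _≡_ _≡_ g → (∀ j → g j ≢ x) → Injective _≡_ _≡_ (x ∷ g)
∷-injective g-inj fresh {zero}  {zero}  eq = refl
∷-injective g-inj fresh {zero}  {suc j} eq = contradiction (sym eq) (fresh j)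
∷-injective g-inj fresh {suc i} {zero}  eq = contradiction eq (fresh i)
∷-injective g-inj fresh {suc i} {suc j} eq = cong suc (g-inj eq)

miss-or-hit : (g : Fin m → Fin n) (x : Fin n) → (∀ j → g j ≢ x) ⊎ (∃ λ j → g j ≡ x)
miss-or-hit g x with any? (λ j → g j ≟ x)
... | yes hit = inj₂ hit
... | no miss = inj₁ λ j eq → miss (j , eq)

injective⇒covers : {h : Fin r → Fin r} → Injective _≡_ _≡_ h → ∀ i → ∃ λ j → h j ≡ i
injective⇒covers {r} {h} h-inj i with miss-or-hit h i
... | inj₂ hit  = hit
... | inj₁ miss = contradiction (injective⇒≤ (∷-injective h-inj miss)) (<⇒≱ (n<1+n r))

-- If every point had a preimage, choosing preimages would give a section of `g`, an injection of
-- `Fin n` into the smaller `Fin m`.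
missed-point : m < n → (g : Fin m → Fin n) → ∃ λ x → ∀ j → g j ≢ x
missed-point m<n g with some-or-all (miss-or-hit g)
... | inj₁ missed  = missed
... | inj₂ section = contradiction (injective⇒≤ section-injective) (<⇒≱ m<n)
  where
  section-injective : Injective _≡_ _≡_ (proj₁ ∘ section)
  section-injective {x} {y} eq =
    trans (sym (proj₂ (section x))) (trans (cong g eq) (proj₂ (section y)))

-- Greedy choice: each new value is a point missed by `g` and by the values chosen before. It
-- supplies the colours left for a copy of `H` once those of its neighbours are reserved.
avoiding : ∀ m (g : Fin r → Fin n) → r + m ≤ n →
           ∃ λ (e : Fin m → Fin n) → Injective _≡_ _≡_ e × (∀ i j → e i ≢ g j)
avoiding zero g _ = (λ ()) , (λ { {()} }) , λ ()
avoiding {r} {n} (suc m) g r+m≤n with avoiding m g (≤-trans (+-monoʳ-≤ r (n≤1+n m)) r+m≤n)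
... | e , e-inj , e-avoids = x ∷ e , ∷-injective e-inj x∉e , λ { zero → x∉g ; (suc i) → e-avoids i }
  where
  both : Fin (r + m) → Fin n
  both = [ g , e ] ∘ Inverse.to +↔⊎
  missed : ∃ λ x → ∀ j → both j ≢ x
  missed = missed-point (≤-trans (≤-reflexive (sym (+-suc r m))) r+m≤n) both
  x : Fin n
  x = proj₁ missed
  both-from : ∀ s → both (Inverse.from +↔⊎ s) ≡ [ g , e ] s
  both-from s = cong [ g , e ] (Inverse.strictlyInverseˡ +↔⊎ s)
  x∉e : ∀ j → e j ≢ x
  x∉e j eq = proj₂ missed _ (trans (both-from (inj₂ j)) eq)
  x∉g : ∀ j → x ≢ g j
  x∉g j eq = proj₂ missed _ (trans (both-from (inj₁ j)) (sym eq))

-- Cliques and Folkman graphs on arbitrary vertex types.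

Clique : Rel V 0ℓ → (Fin a → V) → Set
Clique _~_ q = ∀ i j → i ≢ j → q i ~ q j

MonoClique : Rel V 0ℓ → (V → Fin r) → ℕ → Set
MonoClique {V} _~_ c a = ∃ λ i → ∃ λ (q : Fin a → V) → Clique _~_ q × (∀ j → c (q j) ≡ i)

-- For r ≥ 1, a ≥ 1 this is membership in 𝓕^χ(r, a, a + 1), stated for arbitrary vertex types.
record IsFolkman (r a : ℕ) {V : Set} (_~_ : Rel V 0ℓ) : Set where
  field
    arrows : (c : V → Fin r) → MonoClique _~_ c a
    free   : (q : Fin (suc a) → V) → ¬ Clique _~_ q
    colour : V → Fin (r * (a ∸ 1) + 1)
    proper : ∀ {u v} → u ~ v → colour u ≢ colour v

clique-reflect : (_~_ : Rel V 0ℓ) (_≈_ : Rel W 0ℓ) {q : Fin a → W} (ι : V → W) →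
                 (∀ {x y} → ι x ≈ ι y → x ~ y) → Clique _≈_ q →
                 (lift : ∀ j → ∃ λ x → q j ≡ ι x) → Clique _~_ (proj₁ ∘ lift)
clique-reflect _~_ _≈_ ι reflect clique lift i j i≢j =
  reflect (subst₂ _≈_ (proj₂ (lift i)) (proj₂ (lift j)) (clique i j i≢j))

clique-∘ : (_~_ : Rel V 0ℓ) {q : Fin a → V} {e : Fin m → Fin a} →
           Injective _≡_ _≡_ e → Clique _~_ q → Clique _~_ (q ∘ e)
clique-∘ _ e-inj clique i j i≢j = clique _ _ (i≢j ∘ e-inj)

clique-∷ : (_~_ : Rel V 0ℓ) {q : Fin a → V} {v : V} → Symmetric _~_ →
           (∀ j → v ~ q j) → Clique _~_ q → Clique _~_ (v ∷ q)
clique-∷ _ ~-sym joined clique zero    zero    i≢j = contradiction refl i≢j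
clique-∷ _ ~-sym joined clique zero    (suc j) i≢j = joined j
clique-∷ _ ~-sym joined clique (suc i) zero    i≢j = ~-sym (joined i)
clique-∷ _ ~-sym joined clique (suc i) (suc j) i≢j = clique i j (i≢j ∘ cong suc)

some-inj₂-or-all-inj₁ : (q : Fin n → V ⊎ W) → (∃ λ j → ∃ λ y → q j ≡ inj₂ y) ⊎ (∀ j → ∃ λ x → q j ≡ inj₁ x)
some-inj₂-or-all-inj₁ q = some-or-all λ j → cases (q j)
  where
  cases : (z : _ ⊎ _) → (∃ λ y → z ≡ inj₂ y) ⊎ (∃ λ x → z ≡ inj₁ x)
  cases (inj₁ x) = inj₂ (x , refl)
  cases (inj₂ y) = inj₁ (y , refl)

-- Targets are loopless, so homomorphisms keep clique sizes; the two maps need not be mutually inverse.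
Folkman-transfer : {_~_ : Rel V 0ℓ} {_≈_ : Rel W 0ℓ} (to : W → V) (from : V → W) →
                   (∀ {x y} → x ≈ y → to x ~ to y) → (∀ {u v} → u ~ v → from u ≈ from v) →
                   IsFolkman r a _~_ → IsFolkman r a _≈_
Folkman-transfer to from to-hom from-hom F = record
  { arrows = λ c → let i , q , clique , mono = arrows (c ∘ from)
                   in i , from ∘ q , (λ j l j≢l → from-hom (clique j l j≢l)) , mono
  ; free   = λ q clique → free (to ∘ q) (λ j l j≢l → to-hom (clique j l j≢l))
  ; colour = colour ∘ to
  ; proper = proper ∘ to-hom
  }
  where open IsFolkman F

HasFolkmanGraph : ℕ → ℕ → ℕ → Set₁
HasFolkmanGraph r a n = ∃ λ (G : Graph n) → IsFolkman r a (Graph._~_ G)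

enumerated : {_~_ : Rel V 0ℓ} → Fin n ↔ V → Decidable _~_ → Symmetric _~_ → (∀ {v} → ¬ v ~ v) →
             IsFolkman r a _~_ → HasFolkmanGraph r a n
enumerated {_~_ = _~_} iso ~-dec ~-sym ~-irrefl F = G , Folkman-transfer to from id from-hom F
  where
  open Inverse iso
  G : Graph _
  G = record
    { _~_      = λ x y → to x ~ to y
    ; ~-dec    = λ x y → ~-dec (to x) (to y)
    ; ~-sym    = ~-sym
    ; ~-irrefl = λ { refl → ~-irrefl }
    }
  from-hom : ∀ {u v} → u ~ v → to (from u) ~ to (from v)
  from-hom = subst₂ _~_ (sym (strictlyInverseˡ _)) (sym (strictlyInverseˡ _))

-- Frames and their enlargement by one layer.

-- The part made of u and G₁, …, G_k, for s = d + 1; its m tuples are encoded in mixed radix as Fin m.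
-- v ▷ t means that v will be joined to the copy H_t.
record Frame (d k n m : ℕ) : Set₁ where
  infix 4 _~_ _▷_
  field
    Vertex      : Set
    enum        : Fin n ↔ Vertex
    _~_         : Rel Vertex 0ℓ
    ~-dec       : Decidable _~_
    ~-sym       : Symmetric _~_
    ~-irrefl    : ∀ {v} → ¬ v ~ v
    free        : (q : Fin (suc (suc d)) → Vertex) → ¬ Clique _~_ q
    colour      : Vertex → Fin (k * d + 1)
    proper      : ∀ {u v} → u ~ v → colour u ≢ colour v
    _▷_         : REL Vertex (Fin m) 0ℓ
    ▷-dec       : Decidable _▷_
    independent : ∀ {u v t} → u ▷ t → v ▷ t → ¬ u ~ v
    palette     : Fin m → Fin (suc k) → Fin (k * d + 1)
    palette-▷   : ∀ {v t} → v ▷ t → ∃ λ j → colour v ≡ palette t j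
    -- The number `r` of colours is arbitrary: a frame with few layers must also serve inside a
    -- larger one, where more colours are in use.
    rainbow     : (c : Vertex → Fin r) → MonoClique _~_ c (suc d) ⊎
                  (∃ λ t → ∃ λ (h : Fin (suc k) → Fin r) →
                   Injective _≡_ _≡_ h × (∀ j → ∃ λ v → v ▷ t × c v ≡ h j))

base : Frame d 0 1 1
base = record
  { Vertex      = ⊤
  ; enum        = mk↔ₛ′ (λ _ → tt) (λ _ → zero) (λ _ → refl) (λ { zero → refl })
  ; _~_         = λ _ _ → ⊥
  ; ~-dec       = λ _ _ → no λ ()
  ; ~-sym       = λ ()
  ; ~-irrefl    = λ ()
  ; free        = λ q clique → clique zero (suc zero) λ ()
  ; colour      = λ _ → zero
  ; proper      = λ ()
  ; _▷_         = λ _ _ → ⊤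
  ; ▷-dec       = λ _ _ → yes tt
  ; independent = λ _ _ ()
  ; palette     = λ _ _ → zero
  ; palette-▷   = λ _ → zero , refl
  ; rainbow     = λ c → inj₂ (zero , (λ _ → c tt) , (λ { {zero} {zero} _ → refl }) , λ _ → tt , tt , refl)
  }

-- The new layer is a disjoint summand, so cliques stay on one side and both proper colourings may
-- reuse the same colours. Each tuple gains one entry, which selects a colour class of the new
-- layer; this adds one colour to its palette.
extend : Frame d k n m → HasFolkmanGraph (suc k) (suc d) l → Frame d (suc k) (n + l) (m * (suc k * d + 1))
extend {d} {k} {n} {m} {l} F (G , G-Folkman) = record
  { Vertex      = V′
  ; enum        = (enum ⊎-↔ ↔-id _) ↔-∘ +↔⊎
  ; _~_         = _~′_
  ; ~-dec       = ⊎-decidable ~-dec G.~-dec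
  ; ~-sym       = ⊎-symmetric ~-sym G.~-sym
  ; ~-irrefl    = λ { (inj₁ e) → ~-irrefl e ; (inj₂ e) → G.~-irrefl refl e }
  ; free        = free′
  ; colour      = colour′
  ; proper      = λ { (inj₁ e) → proper e ∘ inject≤-injective b≤b′ b≤b′ _ _ ; (inj₂ e) → H.proper e }
  ; _▷_         = _▷′_
  ; ▷-dec       = λ { (inj₁ v) t → ▷-dec v (old t) ; (inj₂ x) t → H.colour x ≟ new t }
  ; independent = λ { x▷t y▷t (inj₁ e) → independent x▷t y▷t e
                    ; x▷t y▷t (inj₂ e) → H.proper e (trans x▷t (sym y▷t)) }
  ; palette     = λ t → new t ∷ (λ j → inject≤ (palette (old t) j) b≤b′)
  ; palette-▷   = λ { {inj₁ v} v▷t → let j , eq = palette-▷ v▷t in suc j , cong (λ z → inject≤ z b≤b′) eq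
                    ; {inj₂ x} x▷t → zero , x▷t }
  ; rainbow     = rainbow′
  }
  where
  open Frame F
  module G = Graph G
  module H = IsFolkman G-Folkman

  b′ : ℕ
  b′ = suc k * d + 1

  b≤b′ : k * d + 1 ≤ b′
  b≤b′ = +-monoˡ-≤ 1 (m≤n+m (k * d) d)

  V′ : Set
  V′ = Vertex ⊎ Fin l

  _~′_ : Rel V′ 0ℓ
  _~′_ = Pointwise _~_ G._~_

  old : Fin (m * b′) → Fin m
  old = quotient b′

  new : Fin (m * b′) → Fin b′
  new = remainder {m} b′

  colour′ : V′ → Fin b′
  colour′ (inj₁ v) = inject≤ (colour v) b≤b′
  colour′ (inj₂ x) = H.colour x

  _▷′_ : REL V′ (Fin (m * b′)) 0ℓ
  inj₁ v ▷′ t = v ▷ old t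
  inj₂ x ▷′ t = H.colour x ≡ new t

  same-some-inj₂-or-all-inj₁ : ∀ {z x} → z ~′ inj₂ x → ∃ λ y → z ≡ inj₂ y
  same-some-inj₂-or-all-inj₁ (inj₂ _) = _ , refl

  free′ : (q : Fin (suc (suc d)) → V′) → ¬ Clique _~′_ q
  free′ q clique with some-inj₂-or-all-inj₁ q
  ... | inj₂ left = free _ (clique-reflect _~_ _~′_ inj₁ drop-inj₁ clique left)
  ... | inj₁ (j , x , qj) = H.free _ (clique-reflect G._~_ _~′_ inj₂ drop-inj₂ clique right)
    where
    right : ∀ i → ∃ λ y → q i ≡ inj₂ y
    right i with i ≟ j
    ... | yes refl = x , qj
    ... | no i≢j   = same-some-inj₂-or-all-inj₁ (subst (q i ~′_) qj (clique i j i≢j))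

  rainbow′ : (c : V′ → Fin r) → MonoClique _~′_ c (suc d) ⊎
             (∃ λ t → ∃ λ (h : Fin (suc (suc k)) → Fin r) →
              Injective _≡_ _≡_ h × (∀ j → ∃ λ v → v ▷′ t × c v ≡ h j))
  rainbow′ {r} c with rainbow (c ∘ inj₁)
  ... | inj₁ (i , q , clique , mono) = inj₁ (i , inj₁ ∘ q , (λ j l j≢l → inj₁ (clique j l j≢l)) , mono)
  ... | inj₂ (t , h , h-inj , seen) with some-or-all (λ x → miss-or-hit h (c (inj₂ x)))
  -- With no fresh colour in the layer, pulling its colouring back along `h` leaves `suc k` colours,
  -- so the arrowing property of `G` applies.
  ...   | inj₂ known =
    let i , q , clique , mono = H.arrows (proj₁ ∘ known)
    in inj₁ (h i , inj₂ ∘ q , (λ j l j≢l → inj₂ (clique j l j≢l)) ,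
             λ j → trans (sym (proj₂ (known (q j)))) (cong h (mono j)))
  -- The tuple is extended by the proper colour of `x`, which places `x` in the selected class.
  ...   | inj₁ (x , fresh) = inj₂ (t′ , c (inj₂ x) ∷ h , ∷-injective h-inj fresh , seen′)
    where
    t′ : Fin (m * b′)
    t′ = combine t (H.colour x)
    seen′ : ∀ j → ∃ λ v → v ▷′ t′ × c v ≡ (c (inj₂ x) ∷ h) j
    seen′ zero    = inj₂ x , cong proj₂ (sym (remQuot-combine t (H.colour x))) , refl
    seen′ (suc j) =
      let v , v▷t , eq = seen j
      in inj₁ v , subst (v ▷_) (cong proj₁ (sym (remQuot-combine t (H.colour x)))) v▷t , eq

-- Attaching the copies of `H` to a frame.

data Attach {T : Set} (_~_ : Rel V 0ℓ) (_▷_ : REL V T 0ℓ) (_≈_ : Rel W 0ℓ) : Rel (V ⊎ (T × W)) 0ℓ where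
  frame   : ∀ {u v} → u ~ v → Attach _~_ _▷_ _≈_ (inj₁ u) (inj₁ v)
  attachˡ : ∀ {v t x} → v ▷ t → Attach _~_ _▷_ _≈_ (inj₁ v) (inj₂ (t , x))
  attachʳ : ∀ {v t x} → v ▷ t → Attach _~_ _▷_ _≈_ (inj₂ (t , x)) (inj₁ v)
  copy    : ∀ {t x y} → x ≈ y → Attach _~_ _▷_ _≈_ (inj₂ (t , x)) (inj₂ (t , y))

close : Frame (suc d) k n m → HasFolkmanGraph (suc k) (suc d) l →
        HasFolkmanGraph (suc k) (suc (suc d)) (n + m * l)
close {d} {k} {n} {m} {l} F (H , H-Folkman) =
  enumerated ((enum ⊎-↔ *↔×) ↔-∘ +↔⊎) E-dec E-sym E-irrefl record
    { arrows = arrows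
    ; free   = E-free
    ; colour = colour′
    ; proper = proper′
    }
  where
  open Frame F
  module G = Graph H
  module H = IsFolkman H-Folkman

  V′ : Set
  V′ = Vertex ⊎ (Fin m × Fin l)

  E : Rel V′ 0ℓ
  E = Attach _~_ _▷_ G._~_

  E-dec : Decidable E
  E-dec (inj₁ u) (inj₁ v) = map′ frame (λ { (frame e) → e }) (~-dec u v)
  E-dec (inj₁ v) (inj₂ (t , x)) = map′ attachˡ (λ { (attachˡ e) → e }) (▷-dec v t)
  E-dec (inj₂ (t , x)) (inj₁ v) = map′ attachʳ (λ { (attachʳ e) → e }) (▷-dec v t)
  E-dec (inj₂ (t , x)) (inj₂ (s , y)) =
    map′ (λ { (refl , e) → copy e }) (λ { (copy e) → refl , e }) (t ≟ s ×-dec G.~-dec x y)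

  E-sym : Symmetric E
  E-sym (frame e)   = frame (~-sym e)
  E-sym (attachˡ e) = attachʳ e
  E-sym (attachʳ e) = attachˡ e
  E-sym (copy e)    = copy (G.~-sym e)

  E-irrefl : ∀ {z} → ¬ E z z
  E-irrefl (frame e) = ~-irrefl e
  E-irrefl (copy e)  = G.~-irrefl refl e

  arrows : (c : V′ → Fin (suc k)) → MonoClique E c (suc (suc d))
  arrows c with rainbow (c ∘ inj₁)
  ... | inj₁ (i , p , clique , mono) = i , inj₁ ∘ p , (λ j l j≢l → frame (clique j l j≢l)) , mono
  ... | inj₂ (t , h , h-inj , seen) =
    let i , p , clique , mono = H.arrows (λ x → c (inj₂ (t , x)))
        -- The `suc k` distinct colours of `h` are all the colours there are, so the colour `i` of
        -- the clique found in the copy also occurs on an attached frame vertex.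
        j , hj≡i = injective⇒covers h-inj i
        v , v▷t , cv≡hj = seen j
    in i , inj₁ v ∷ (λ l → inj₂ (t , p l)) ,
       clique-∷ E E-sym (λ _ → attachˡ {t = t} v▷t) (λ j l j≢l → copy (clique j l j≢l)) ,
       λ { zero → trans cv≡hj hj≡i ; (suc l) → mono l }

  same-copy : ∀ {z t x} → E z (inj₂ (t , x)) → (∃ λ v → z ≡ inj₁ v × v ▷ t) ⊎ (∃ λ y → z ≡ inj₂ (t , y))
  same-copy (attachˡ e) = inj₁ (_ , refl , e)
  same-copy (copy e)    = inj₂ (_ , refl)

  reflect-copy : ∀ {t x y} → E (inj₂ (t , x)) (inj₂ (t , y)) → x G.~ y
  reflect-copy (copy e) = e

  -- Distinct copies are not adjacent, and the frame vertices attached to one copy are independent.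
  -- A clique that meets a copy therefore has at most one vertex outside it, and the rest is too
  -- large for `H`.
  E-free : (p : Fin (suc (suc (suc d))) → V′) → ¬ Clique E p
  E-free p clique with some-inj₂-or-all-inj₁ p
  ... | inj₂ left = free _ (clique-reflect _~_ E inj₁ (λ { (frame e) → e }) clique left)
  ... | inj₁ (j , (t , x) , pj) with some-or-all classify
    where
    classify : ∀ i → (∃ λ v → p i ≡ inj₁ v × v ▷ t) ⊎ (∃ λ y → p i ≡ inj₂ (t , y))
    classify i with i ≟ j
    ... | yes refl = inj₂ (x , pj)
    ... | no i≢j   = same-copy (subst (E (p i)) pj (clique i j i≢j))
  -- Here the clique is one vertex larger than needed, so its first vertex is dropped.
  ...   | inj₂ inside =
    H.free _ (clique-reflect G._~_ E (λ y → inj₂ (t , y)) reflect-copy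
               (clique-∘ E suc-injective clique) (inside ∘ suc))
  ...   | inj₁ (i , v , pi , v▷t) =
    H.free _ (clique-reflect G._~_ E (λ y → inj₂ (t , y)) reflect-copy
               (clique-∘ E (punchIn-injective i _ _) clique) others)
    where
    others : ∀ l → ∃ λ y → p (punchIn i l) ≡ inj₂ (t , y)
    others l with punchIn i l ≟ j
    ... | yes eq = x , trans (cong p eq) pj
    ... | no l≢j with same-copy (subst (E (p (punchIn i l))) pj (clique _ j l≢j))
    ...   | inj₂ inside = inside
    ...   | inj₁ (w , pw , w▷t) =
      contradiction (reflect-frame (subst₂ E pi pw (clique i _ (≢-sym (punchInᵢ≢i i l)))))
                    (independent v▷t w▷t)
      where
      reflect-frame : ∀ {u v} → E (inj₁ u) (inj₁ v) → u ~ v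
      reflect-frame (frame e) = e

  b′ : ℕ
  b′ = suc k * suc d + 1

  b≤b′ : k * suc d + 1 ≤ b′
  b≤b′ = +-monoˡ-≤ 1 (m≤n+m (k * suc d) (suc d))

  -- In fact an equality: the palette and the colours of `H` fill `b′` exactly.
  room : suc k + (suc k * d + 1) ≤ b′
  room = ≤-reflexive (trans (sym (+-assoc (suc k) (suc k * d) 1)) (cong (_+ 1) (sym (*-suc (suc k) d))))

  outer : Vertex → Fin b′
  outer v = inject≤ (colour v) b≤b′

  inner : ∀ t → ∃ λ (e : Fin (suc k * d + 1) → Fin b′) →
          Injective _≡_ _≡_ e × (∀ i j → e i ≢ inject≤ (palette t j) b≤b′)
  inner t = avoiding _ (λ j → inject≤ (palette t j) b≤b′) room

  colour′ : V′ → Fin b′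
  colour′ (inj₁ v)       = outer v
  colour′ (inj₂ (t , x)) = proj₁ (inner t) (H.colour x)

  attached-differ : ∀ {v t} x → v ▷ t → colour′ (inj₂ (t , x)) ≢ outer v
  attached-differ {v} {t} x v▷t eq =
    let j , same = palette-▷ v▷t
    in proj₂ (proj₂ (inner t)) (H.colour x) j (trans eq (cong (λ z → inject≤ z b≤b′) same))

  proper′ : ∀ {y z} → E y z → colour′ y ≢ colour′ z
  proper′ (frame e)            = proper e ∘ inject≤-injective b≤b′ b≤b′ _ _
  proper′ (attachˡ {x = x} e)  = ≢-sym (attached-differ x e)
  proper′ (attachʳ {x = x} e)  = attached-differ x e
  proper′ (copy {t = t} e)     = H.proper e ∘ proj₁ (proj₂ (inner t))

-- Orders of layered frames, and existence of Folkman graphs.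

map-interval : ∀ (f : ℕ → ℕ) k → map f (interval 1 (suc k)) ≡ map f (interval 1 k) ∷ʳ f (suc k)
map-interval f k = trans (cong (map f) (sym (applyUpTo-∷ʳ suc k))) (map-++ f (interval 1 k) _)

sum-interval : ∀ (f : ℕ → ℕ) k → sum (map f (interval 1 (suc k))) ≡ sum (map f (interval 1 k)) + f (suc k)
sum-interval f k =
  trans (cong sum (map-interval f k))
        (trans (sum-++ (map f (interval 1 k)) _) (cong (sum (map f (interval 1 k)) +_) (+-identityʳ _)))

product-interval : ∀ (f : ℕ → ℕ) k →
                   product (map f (interval 1 (suc k))) ≡ product (map f (interval 1 k)) * f (suc k)
product-interval f k =
  trans (cong product (map-interval f k))
        (trans (product-++ (map f (interval 1 k)) _) (cong (product (map f (interval 1 k)) *_) (*-identityʳ _)))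

-- The leading 1 counts the vertex u. The graph G₁ is an ordinary layer here, so the sum and the
-- product both start at 1.
layered : ∀ (f : ℕ → ℕ) k → (∀ i → 1 ≤ i → i ≤ k → HasFolkmanGraph i (suc d) (f i)) →
          Frame d k (1 + sum (map f (interval 1 k))) (product (map (λ i → i * d + 1) (interval 1 k)))
layered f zero    layer = base
layered {d} f (suc k) layer =
  subst₂ (Frame d (suc k)) (cong suc (sym (sum-interval f k))) (sym (product-interval (λ i → i * d + 1) k))
    (extend (layered f k λ i 1≤i i≤k → layer i 1≤i (m≤n⇒m≤1+n i≤k)) (layer (suc k) (s≤s z≤n) ≤-refl))

single-vertex : HasFolkmanGraph (suc k) 1 1
single-vertex {k} = G , record
  { arrows = λ c → c zero , (λ _ → zero) , (λ { zero zero 0≢0 → contradiction refl 0≢0 }) , λ _ → refl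
  ; free   = λ q clique → clique zero (suc zero) λ ()
  ; colour = λ _ → subst Fin (+-comm 1 (suc k * 0)) zero
  ; proper = λ ()
  }
  where
  G : Graph 1
  G = record { _~_ = λ _ _ → ⊥ ; ~-dec = λ _ _ → no λ () ; ~-sym = λ () ; ~-irrefl = λ _ () }

-- `frame-exists d` concerns s = d + 2. Each new layer is obtained by closing the frame built so far
-- with a graph for s - 1, so the recursion descends in `d`, and in `k` for fixed `d`.
folkman-exists : ∀ d k → ∃ λ n → HasFolkmanGraph (suc k) (suc d) n
frame-exists   : ∀ d k → ∃ λ n → ∃ λ m → Frame (suc d) k n m

folkman-exists zero    k = 1 , single-vertex
folkman-exists (suc d) k =
  let _ , _ , F = frame-exists d k
      _ , H = folkman-exists d k
  in _ , close F H

frame-exists d zero    = 1 , 1 , base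
frame-exists d (suc k) =
  let _ , _ , F = frame-exists d k
      _ , H = folkman-exists d k
  in _ , _ , extend F (close F H)

-- Closing `base` joins a single vertex to a single copy, so this builds complete graphs by repeated
-- coning.
complete : ∀ d → HasFolkmanGraph 1 (suc d) (suc d)
complete zero    = single-vertex
complete (suc d) = subst (HasFolkmanGraph 1 (suc (suc d))) (cong suc (+-identityʳ (suc d))) (close base (complete d))

-- Deciding whether a Folkman graph of a given order exists.

-- Maps between finite sets are searched through their codes. Decoding a code returns the map only
-- up to pointwise equality, which `P` must therefore respect.
decide-∃ : {P : (Fin m → Fin n) → Set} → (∀ {g h} → g ≗ h → P g → P h) → (∀ g → Dec (P g)) → Dec (∃ P)
decide-∃ resp P? =
  map′ (λ (i , p) → _ , p)
       (λ (g , p) → funToFin g , resp (λ x → sym (finToFun-funToFin g x)) p)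
       (any? (P? ∘ finToFun))

decide-∀ : {P : (Fin m → Fin n) → Set} → (∀ {g h} → g ≗ h → P g → P h) → (∀ g → Dec (P g)) → Dec (∀ g → P g)
decide-∀ resp P? =
  map′ (λ p g → resp (finToFun-funToFin g) (p (funToFin g))) (λ p i → p (finToFun i))
       (all? (P? ∘ finToFun))

isFolkman? : ∀ r a (G : Graph n) → Dec (IsFolkman r a (Graph._~_ G))
isFolkman? {n} r a G =
  map′ (λ (arr , fr , c , pr) → record { arrows = arr ; free = λ q cl → fr (q , cl) ; colour = c ; proper = pr _ _ })
       (λ F → let open IsFolkman F in arrows , (λ (q , cl) → free q cl) , colour , λ _ _ → proper)
       (arrows? ×-dec ¬? (decide-∃ clique-resp clique?) ×-dec
        decide-∃ (λ g≗h p u v u~v → subst₂ _≢_ (g≗h u) (g≗h v) (p u v u~v))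
                 (λ c → all? λ u → all? λ v → ~-dec u v →-dec ¬? (c u ≟ c v)))
  where
  open Graph G
  clique? : (q : Fin l → Fin n) → Dec (Clique _~_ q)
  clique? q = all? λ i → all? λ j → ¬? (i ≟ j) →-dec ~-dec (q i) (q j)
  clique-resp : {p q : Fin l → Fin n} → p ≗ q → Clique _~_ p → Clique _~_ q
  clique-resp p≗q cl i j i≢j = subst₂ _~_ (p≗q i) (p≗q j) (cl i j i≢j)
  arrows? : Dec ((c : Fin n → Fin r) → MonoClique _~_ c a)
  arrows? =
    decide-∀ (λ g≗h (i , q , cl , mono) → i , q , cl , λ j → trans (sym (g≗h (q j))) (mono j)) λ c →
    any? λ i →
    decide-∃ (λ p≗q (cl , mono) → clique-resp p≗q cl , λ j → trans (cong c (sym (p≗q j))) (mono j)) λ q →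
    clique? q ×-dec all? (λ j → c (q j) ≟ i)

-- Symmetrised with loops removed, so that every code denotes a graph.
coded : Fin ((2 ^ n) ^ n) → Graph n
coded {n} e = record
  { _~_      = λ u v → u ≢ v × (bit u v ⊎ bit v u)
  ; ~-dec    = λ u v → ¬? (u ≟ v) ×-dec (bit? u v ⊎-dec bit? v u)
  ; ~-sym    = λ (u≢v , b) → ≢-sym u≢v , swap b
  ; ~-irrefl = λ u≡v (u≢v , _) → u≢v u≡v
  }
  where
  bit : Rel (Fin n) 0ℓ
  bit u v = finToFun (finToFun {2 ^ n} {n} e u) v ≡ suc zero
  bit? : Decidable bit
  bit? u v = finToFun (finToFun {2 ^ n} {n} e u) v ≟ suc zero

truth : {P : Set} → Dec P → Fin 2
truth (yes _) = suc zero
truth (no  _) = zero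

truth⁺ : {P : Set} (P? : Dec P) → P → truth P? ≡ suc zero
truth⁺ (yes _) _ = refl
truth⁺ (no ¬p) p = contradiction p ¬p

truth⁻ : {P : Set} (P? : Dec P) → truth P? ≡ suc zero → P
truth⁻ (yes p) _ = p

code : Graph n → Fin ((2 ^ n) ^ n)
code G = funToFin λ u → funToFin λ v → truth (Graph.~-dec G u v)

code-bit : (G : Graph n) → ∀ u v →
           finToFun (finToFun {2 ^ n} {n} (code G) u) v ≡ truth (Graph.~-dec G u v)
code-bit G u v =
  trans (cong (λ z → finToFun z v) (finToFun-funToFin (λ u → funToFin λ v → truth (Graph.~-dec G u v)) u))
        (finToFun-funToFin (λ v → truth (Graph.~-dec G u v)) v)

hasFolkmanGraph? : ∀ r a n → Dec (HasFolkmanGraph r a n)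
hasFolkmanGraph? r a n = map′ (λ (e , F) → coded e , F) encode (any? λ e → isFolkman? r a (coded e))
  where
  encode : HasFolkmanGraph r a n → ∃ λ e → IsFolkman r a (Graph._~_ (coded {n} e))
  encode (G , F) = code G , Folkman-transfer id id decode encode-edge F
    where
    open Graph G
    decode : ∀ {u v} → Graph._~_ (coded (code G)) u v → u ~ v
    decode {u} {v} (_ , inj₁ b) = truth⁻ (~-dec u v) (trans (sym (code-bit G u v)) b)
    decode {u} {v} (_ , inj₂ b) = ~-sym (truth⁻ (~-dec v u) (trans (sym (code-bit G v u)) b))
    encode-edge : ∀ {u v} → u ~ v → Graph._~_ (coded (code G)) u v
    encode-edge {u} {v} u~v =
      (λ u≡v → ~-irrefl u≡v u~v) , inj₁ (trans (code-bit G u v) (truth⁺ (~-dec u v) u~v))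

-- Minimal orders, chromatic numbers and the final bound.

minimum : ∀ {p} {P : Pred ℕ p} → (∀ n → Dec (P n)) → ∀ n → P n → ∃ (IsMinimum P)
minimum {P = P} P? = <-rec _ λ n rec Pn → search n rec Pn
  where
  search : ∀ n → (∀ {k} → k < n → P k → ∃ (IsMinimum P)) → P n → ∃ (IsMinimum P)
  search n rec Pn with anyUpTo? P? n
  ... | yes (k , k<n , Pk) = rec k<n Pk
  ... | no none            = n , Pn , λ k Pk → ≮⇒≥ λ k<n → none (k , k<n , Pk)

-- Colours are merged by quotient d; the pigeonhole acts on the remainders along a monochromatic clique.
chromatic-bound : {_~_ : Rel V 0ℓ} → (∀ (c : V → Fin r) → MonoClique _~_ c (suc d)) →
                  (c : V → Fin k) → (∀ u v → u ~ v → c u ≢ c v) → r * d + 1 ≤ k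
chromatic-bound {r = r} {d = d} {k = k} {_~_ = _~_} arrows c proper =
  subst (_≤ k) (+-comm 1 (r * d)) (≮⇒≥ λ k<1+rd → few (s≤s⁻¹ k<1+rd))
  where
  few : ¬ k ≤ r * d
  few k≤rd with arrows (λ v → quotient d (inject≤ (c v) k≤rd))
  ... | i , q , clique , mono with pigeonhole (n<1+n d) (λ j → remainder {r} d (inject≤ (c (q j)) k≤rd))
  ...   | x , y , x<y , same =
    proper _ _ (clique x y (<⇒≢ x<y)) (inject≤-injective k≤rd k≤rd _ _
      (trans (sym (combine-remQuot {r} d _))
        (trans (cong₂ combine (trans (mono x) (sym (mono y))) same) (combine-remQuot {r} d _))))

-- A variable `t` with an equation covers both forms of the clique bound, `s + 1` and `s`, without
-- transports.
HasFχGraph⁺ : ∀ {t} → t ≡ suc (suc d) → HasFolkmanGraph (suc k) (suc d) n → HasFχGraph (suc k) (suc d) t n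
HasFχGraph⁺ {d} refl (G , F) = G , record
  { arrows    = arrows
  -- The constant colouring turns arrowing into a clique on `suc d` vertices, so the clique number
  -- is attained.
  ; clique    = suc d , ((let _ , q , cl , _ = arrows (λ _ → zero) in q , cl) , maximal) , n<1+n (suc d)
  ; chromatic = (colour , λ _ _ → proper) , λ k (c , c-proper) → chromatic-bound arrows c c-proper
  }
  where
  open IsFolkman F
  maximal : ∀ l → (∃ λ (q : Fin l → Fin _) → IsClique G q) → l ≤ suc d
  maximal l (q , cl) = ≮⇒≥ λ d<l →
    free _ (clique-∘ (Graph._~_ G) (inject≤-injective d<l d<l _ _) cl)

HasFχGraph⁻ : ∀ {t} → t ≡ suc a → HasFχGraph r a t n → HasFolkmanGraph r a n
HasFχGraph⁻ refl (G , F) = G , record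
  { arrows = arrows
  ; free   = λ q cl → let _ , (_ , maximal) , l<t = clique in <⇒≱ l<t (maximal _ (q , cl))
  ; colour = proj₁ (proj₁ chromatic)
  ; proper = proj₂ (proj₁ chromatic) _ _
  }
  where open InFχ F

Fχ-number : ∀ d k {t} → t ≡ suc (suc d) → ∃ (IsFχ (suc k) (suc d) t)
Fχ-number d k t≡ =
  let n , G = folkman-exists d k
  in minimum (λ n → map′ (HasFχGraph⁺ t≡) (HasFχGraph⁻ t≡) (hasFolkmanGraph? (suc k) (suc d) n))
             n (HasFχGraph⁺ t≡ G)

bound : ∀ (r s : ℕ) → 2 ≤ r → 3 ≤ s →
        FχExists r s (s + 1) ×
        (∃[ p ] Σ[ f ∈ (ℕ → ℕ) ] ∃[ q ]
         IsFχ r s (s + 1) p ×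
         (∀ i → 2 ≤ i → i ≤ r ∸ 1 → IsFχ i s (s + 1) (f i)) ×
         IsFχ r (s ∸ 1) s q ×
         p ≤ 1 + s + sum (map f (interval 2 (r ∸ 1))) + product (map (λ i → i * (s ∸ 1) + 1) (interval 1 (r ∸ 1))) * q)
bound (suc (suc k)) (suc (suc d)) (s≤s (s≤s z≤n)) (s≤s (s≤s (s≤s z≤n))) =
  (p , proj₁ p-min) , p , f , q , p-min , (λ { (suc i) _ _ → proj₂ (number i) }) , q-min ,
  ≤-trans (proj₂ p-min _ (HasFχGraph⁺ t≡ (close (layered f (suc k) layer) (HasFχGraph⁻ refl (proj₁ q-min)))))
          -- The sum over layers from 1 unfolds to `f 1` plus the sum from 2, and the complete graph
          -- on `s` vertices bounds `f 1`.
          (+-monoˡ-≤ _ (s≤s (+-monoˡ-≤ _ f1≤s)))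
  where
  s : ℕ
  s = suc (suc d)
  t≡ : s + 1 ≡ suc s
  t≡ = +-comm s 1
  number : ∀ i → ∃ (IsFχ (suc i) s (s + 1))
  number i = Fχ-number (suc d) i t≡
  f : ℕ → ℕ
  -- A filler value, as layers are numbered from 1.
  f zero    = 0
  f (suc i) = proj₁ (number i)
  p q : ℕ
  p = proj₁ (number (suc k))
  q = proj₁ (Fχ-number d (suc k) refl)
  p-min : IsFχ (suc (suc k)) s (s + 1) p
  p-min = proj₂ (number (suc k))
  q-min : IsFχ (suc (suc k)) (suc d) s q
  q-min = proj₂ (Fχ-number d (suc k) refl)
  layer : ∀ i → 1 ≤ i → i ≤ suc k → HasFolkmanGraph i s (f i)
  layer (suc i) _ _ = HasFχGraph⁻ t≡ (proj₁ (proj₂ (number i)))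
  f1≤s : f 1 ≤ s
  f1≤s = proj₂ (proj₂ (number 0)) s (HasFχGraph⁺ t≡ (complete (suc d)))

theorem3 :
    ( ∀ (r s : ℕ) → 2 ≤ r → 3 ≤ s →
      let b : ℕ → ℕ
          b i = i * (s ∸ 1) + 1
          B : ℕ
          B = product (map b (interval 1 (r ∸ 1)))
      in
      FχExists r s (s + 1) ×
      ( ∃[ p ] Σ[ f ∈ (ℕ → ℕ) ] ∃[ q ]
        IsFχ r s (s + 1) p ×
        (∀ i → 2 ≤ i → i ≤ r ∸ 1 → IsFχ i s (s + 1) (f i)) ×
        IsFχ r (s ∸ 1) s q ×
        p ≤ 1 + s + sum (map f (interval 2 (r ∸ 1))) + B * q ) )
    ×
    ( ∀ (s : ℕ) → 3 ≤ s →
      FχExists 2 s (s + 1) ×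
      ( ∃[ p ] ∃[ q ]
        IsFχ 2 s (s + 1) p ×
        IsFχ 2 (s ∸ 1) s q ×
        p ≤ 1 + s + s * q ) )
theorem3 = bound , two
  where
  two : ∀ s → 3 ≤ s → FχExists 2 s (s + 1) ×
        (∃[ p ] ∃[ q ] IsFχ 2 s (s + 1) p × IsFχ 2 (s ∸ 1) s q × p ≤ 1 + s + s * q)
  two s@(suc d) 3≤s =
    let exists , p , _ , q , p-min , _ , q-min , p≤ = bound 2 s (s≤s (s≤s z≤n)) 3≤s
    in exists , p , q , p-min , q-min ,
       -- For r = 2 the sum is empty and the product is the single factor 1 * (s - 1) + 1 = s.
       subst (p ≤_) (cong₂ (λ x y → x + y * q) (+-identityʳ (1 + s))
         (trans (*-identityʳ (1 * d + 1)) (trans (+-comm (1 * d) 1) (cong suc (*-identityˡ d))))) p≤
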